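{- Let $\alpha=(a_1,\ldots,a_k)$ be a composition of a non-negative integer $n$. Then \[(\zeta^{ -1})_-(M_\alpha)=\begin{cases}\dfrac{(-1)^{k(\alpha)}}{2^{2\lfloor k_o(\alpha)/2\rfloor}}\,C\bigl(0,\lfloor k_o(\alpha)/2\rfloor\bigr)&\text{if } a_1\text{ is odd},\\ 0&\text{if } a_1\text{ is even},\end{cases}\] \[(\zeta^{ -1})_+(M_\alpha)=\begin{cases}\dfrac{(-1)^{k(\alpha)}}{2^{k_o(\alpha)}}\,C\bigl(0,k_o(\alpha)/2\bigr)&\text{if } n\text{ is even},\\0&\text{if } n\text{ is odd.}\end{cases}\]
   Context: $\Bbbk$ is a field of characteristic $\neq2$. A composition $\alpha=(a_1,\ldots,a_k)$ of $n$ is a sequence of positive integers with sum $n$; $k(\alpha)=k$, and $k_o(\alpha)$, $k_e(\alpha)$ are the numbers of odd and even parts. ${\mathcal{Q}Sym}$ is the graded connected Hopf algebra of quasi-symmetric functions over $\Bbbk$ with monomial basis $M_\alpha=\sum_{i_1<\cdots<i_k}x_{i_1}^{a_1}\cdots x_{i_k}^{a_k}$ ($M_{()}=1$), ordinary product, coproduct $\Delta(M_\alpha)=\sum_{i=0}^kM_{(a_1,\ldots,a_i)}\otimes M_{(a_{i+1},\ldots,a_k)}$. Convolution $\rho\psi=m\circ(\rho\otimes\psi)\circ\Delta$; characters (algebra morphisms to $\Bbbk$) form a group under convolution. For a functional $\varphi$, $\bar\varphi(h)=(-1)^n\varphi(h)$ on homogeneous $h$ of degree $n$; $\varphi$ is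 even if $\bar\varphi=\varphi$, odd if $\bar\varphi=\varphi^{ -1}$. Every character $\varphi$ factors uniquely as $\varphi=\varphi_+\varphi_-$ with $\varphi_+$ an even and $\varphi_-$ an odd character. $\zeta$ is the universal character $\zeta(f)=f(1,0,0,\ldots)$ ($\zeta(M_\alpha)=1$ if $\alpha=()$ or $\alpha=(n)$, else $0$), $\zeta^{ -1}$ its convolution inverse, and $(\zeta^{ -1})_+,(\zeta^{ -1})_-$ the even and odd parts of $\zeta^{ -1}$. $C(p,q)=\frac{(2p)!(2q)!}{p!(p+q)!q!}$. -}

module Defs where

open import Algebra.Apartness.Bundles using (HeytingCommutativeRing; HeytingField)
open import Algebra.Bundles using (CommutativeRing; RawRing)
open import Algebra.Definitions.RawSemiring as RawSemiringDefs using ()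
open import Algebra.Morphism.Structures using (module RingMorphisms)
open import Data.Bool.Base using (if_then_else_)
open import Data.List.Base
  using (List; []; _∷_; [_]; _++_; map; concatMap; filter; foldr; length)
open import Data.List.Properties using (map-++; map-∘)
open import Data.Nat.Base as ℕ using (ℕ; zero; suc; NonZero; _≡ᵇ_; _!; ⌊_/2⌋)
open import Data.Nat.Divisibility using (_∣?_)
open import Data.Nat.DivMod using (_/_)
open import Data.Nat.ListAction using (sum)
open import Data.Nat.ListAction.Properties using (sum-++)
open import Data.Nat.Properties
  using (m*n≢0; _!≢0; +-identityʳ; *-distribˡ-+; *-distribʳ-+; *-zeroʳ)
open import Data.Nat.Solver using (module +-*-Solver)
open import Data.Product.Base using (_×_; _,_; proj₁; map₁)
open import Function.Base using (_∘_)
open import Level using (_⊔_)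
open import Relation.Binary.PropositionalEquality
  using (_≡_; refl; sym; trans; cong; cong₂; module ≡-Reasoning)
open import Relation.Nullary.Decidable using (does; ¬?)

record ℕ⁺ : Set where
  constructor pos
  field
    value        : ℕ
    .{{value≢0}} : NonZero value

open ℕ⁺ public using (value)

+-nonZero : ∀ m n .{{_ : NonZero m}} → NonZero (m ℕ.+ n)
+-nonZero (suc _) _ = _

infixl 6 _+⁺_
_+⁺_ : ℕ⁺ → ℕ⁺ → ℕ⁺
pos m +⁺ pos n = pos (m ℕ.+ n) {{+-nonZero m n}}

Composition : Set
Composition = List ℕ⁺

size : Composition → ℕ
size α = sum (map value α)

kₒ : Composition → ℕ
kₒ α = length (filter (λ a → ¬? (2 ∣? value a)) α)

-- Deconcatenation: all (β , γ) with β ++ γ ≡ α.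
deconcat : Composition → List (Composition × Composition)
deconcat []      = [ ([] , []) ]
deconcat (a ∷ α) = ([] , a ∷ α) ∷ map (map₁ (a ∷_)) (deconcat α)

-- Monomials in the ordered variables x₁, x₂, …: the list e₁ ∷ … ∷ eₘ ∷ []
-- stands for x₁^e₁ ⋯ xₘ^eₘ.
Monomial : Set
Monomial = List ℕ

δ : ℕ → ℕ → ℕ
δ m n = if m ≡ᵇ n then 1 else 0

-- M[ α ]at e is the coefficient of the monomial e in
--   M_α = Σ_{i₁ < ⋯ < iₖ} x_{i₁}^a₁ ⋯ x_{iₖ}^aₖ.
-- In the last clause the first summand collects the index sequences with
-- i₁ > 1 and the second those with i₁ = 1.
M[_]at_ : Composition → Monomial → ℕ
M[ []    ]at []      = 1
M[ a ∷ α ]at []      = 0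
M[ []    ]at (n ∷ e) = δ 0 n ℕ.* M[ [] ]at e
M[ a ∷ α ]at (n ∷ e) = δ 0 n ℕ.* M[ a ∷ α ]at e ℕ.+ δ (value a) n ℕ.* M[ α ]at e

-- M_α M_β = Σ M_γ over the γ listed (with multiplicity) in α ⧢ β.
-- ⧢-correct below shows that this is the ordinary product of power series.
infixl 7 _⧢_
_⧢_ : Composition → Composition → List Composition
[]      ⧢ β       = [ β ]
(a ∷ α) ⧢ []      = [ a ∷ α ]
(a ∷ α) ⧢ (b ∷ β) =
  map (a ∷_) (α ⧢ (b ∷ β)) ++
  map (b ∷_) ((a ∷ α) ⧢ β) ++
  map ((a +⁺ b) ∷_) (α ⧢ β)

-- All ways of writing a monomial as a product of two monomials.
splitℕ : ℕ → List (ℕ × ℕ)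
splitℕ zero    = [ (0 , 0) ]
splitℕ (suc n) = (0 , suc n) ∷ map (map₁ suc) (splitℕ n)

factorisations : Monomial → List (Monomial × Monomial)
factorisations []      = [ ([] , []) ]
factorisations (n ∷ e) =
  concatMap (λ (i , j) → map (λ (u , v) → i ∷ u , j ∷ v) (factorisations e)) (splitℕ n)

private
  module Sums {a} {A : Set a} where

    ∑ : (A → ℕ) → List A → ℕ
    ∑ h xs = sum (map h xs)

    ∑-cong : ∀ {f g} → (∀ x → f x ≡ g x) → ∀ xs → ∑ f xs ≡ ∑ g xs
    ∑-cong eq []       = refl
    ∑-cong eq (x ∷ xs) = cong₂ ℕ._+_ (eq x) (∑-cong eq xs)

    ∑-++ : ∀ f xs ys → ∑ f (xs ++ ys) ≡ ∑ f xs ℕ.+ ∑ f ys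
    ∑-++ f xs ys = trans (cong sum (map-++ f xs ys)) (sum-++ (map f xs) (map f ys))

    ∑-+ : ∀ f g xs → ∑ (λ x → f x ℕ.+ g x) xs ≡ ∑ f xs ℕ.+ ∑ g xs
    ∑-+ f g []       = refl
    ∑-+ f g (x ∷ xs) = trans (cong (f x ℕ.+ g x ℕ.+_) (∑-+ f g xs))
      (solve 4 (λ p q r s → (p :+ q) :+ (r :+ s) := (p :+ r) :+ (q :+ s)) refl
        (f x) (g x) (∑ f xs) (∑ g xs))
      where open +-*-Solver

    ∑-* : ∀ c f xs → ∑ (λ x → c ℕ.* f x) xs ≡ c ℕ.* ∑ f xs
    ∑-* c f []       = sym (*-zeroʳ c)
    ∑-* c f (x ∷ xs) =
      trans (cong (c ℕ.* f x ℕ.+_) (∑-* c f xs)) (sym (*-distribˡ-+ c (f x) (∑ f xs)))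

  open Sums

  ∑-map : ∀ {a b} {A : Set a} {B : Set b} (f : B → ℕ) (g : A → B) xs →
          ∑ f (map g xs) ≡ ∑ (f ∘ g) xs
  ∑-map f g xs = cong sum (sym (map-∘ xs))

  ∑-concatMap : ∀ {a b} {A : Set a} {B : Set b} (f : B → ℕ) (g : A → List B) xs →
                ∑ f (concatMap g xs) ≡ ∑ (λ x → ∑ f (g x)) xs
  ∑-concatMap f g []       = refl
  ∑-concatMap f g (x ∷ xs) =
    trans (∑-++ f (g x) (concatMap g xs)) (cong (∑ f (g x) ℕ.+_) (∑-concatMap f g xs))

  ∑-δδ : ∀ x y n → ∑ (λ (i , j) → δ x i ℕ.* δ y j) (splitℕ n) ≡ δ (x ℕ.+ y) n
  ∑-δδ zero    y zero    = trans (+-identityʳ _) (+-identityʳ _)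
  ∑-δδ (suc x) y zero    = refl
  ∑-δδ zero    y (suc n) = trans
    (cong₂ ℕ._+_ (+-identityʳ (δ y (suc n)))
      (trans (∑-map _ (map₁ suc) (splitℕ n)) (∑-* 0 (λ _ → 0) (splitℕ n))))
    (+-identityʳ _)
  ∑-δδ (suc x) y (suc n) = trans (∑-map _ (map₁ suc) (splitℕ n)) (∑-δδ x y n)

  -- The product of the series δ x · p and δ y · r, first variable split off.
  ∑-block : ∀ x y (p r : Monomial → ℕ) n e →
    ∑ (λ (i , j) → ∑ (λ (u , v) → (δ x i ℕ.* p u) ℕ.* (δ y j ℕ.* r v)) (factorisations e))
      (splitℕ n)
    ≡ δ (x ℕ.+ y) n ℕ.* ∑ (λ (u , v) → p u ℕ.* r v) (factorisations e)
  ∑-block x y p r n e = begin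
    ∑ (λ (i , j) → ∑ (λ (u , v) → (δ x i ℕ.* p u) ℕ.* (δ y j ℕ.* r v)) F) (splitℕ n)
      ≡⟨ ∑-cong (λ (i , j) → trans
           (∑-cong (λ (u , v) → rearrange (δ x i) (p u) (δ y j) (r v)) F)
           (∑-* (δ x i ℕ.* δ y j) _ F)) (splitℕ n) ⟩
    ∑ (λ (i , j) → (δ x i ℕ.* δ y j) ℕ.* S) (splitℕ n)
      ≡⟨ ∑-cong (λ (i , j) → *-comm′ (δ x i ℕ.* δ y j) S) (splitℕ n) ⟩
    ∑ (λ (i , j) → S ℕ.* (δ x i ℕ.* δ y j)) (splitℕ n)
      ≡⟨ ∑-* S _ (splitℕ n) ⟩
    S ℕ.* ∑ (λ (i , j) → δ x i ℕ.* δ y j) (splitℕ n)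
      ≡⟨ cong (S ℕ.*_) (∑-δδ x y n) ⟩
    S ℕ.* δ (x ℕ.+ y) n
      ≡⟨ *-comm′ S (δ (x ℕ.+ y) n) ⟩
    δ (x ℕ.+ y) n ℕ.* S ∎
    where
    open ≡-Reasoning
    open +-*-Solver
    F = factorisations e
    S = ∑ (λ (u , v) → p u ℕ.* r v) F
    rearrange : ∀ a b c d → (a ℕ.* b) ℕ.* (c ℕ.* d) ≡ (a ℕ.* c) ℕ.* (b ℕ.* d)
    rearrange = solve 4 (λ a b c d → (a :* b) :* (c :* d) := (a :* c) :* (b :* d)) refl
    *-comm′ : ∀ a b → a ℕ.* b ≡ b ℕ.* a
    *-comm′ = solve 2 (λ a b → a :* b := b :* a) refl

  -- Coefficient of e in the product of the power series p and r.
  cauchy : (p r : Monomial → ℕ) → Monomial → ℕ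
  cauchy p r e = ∑ (λ (u , v) → p u ℕ.* r v) (factorisations e)

  cauchy-∷ : ∀ p r n e → cauchy p r (n ∷ e) ≡
    ∑ (λ (i , j) → ∑ (λ (u , v) → p (i ∷ u) ℕ.* r (j ∷ v)) (factorisations e)) (splitℕ n)
  cauchy-∷ p r n e = trans
    (∑-concatMap _ _ (splitℕ n))
    (∑-cong (λ _ → ∑-map _ _ (factorisations e)) (splitℕ n))

  ∑∑-+ : ∀ (f g : ℕ × ℕ → Monomial × Monomial → ℕ) F G →
    ∑ (λ x → ∑ (λ y → f x y ℕ.+ g x y) F) G ≡ ∑ (λ x → ∑ (f x) F) G ℕ.+ ∑ (λ x → ∑ (g x) F) G
  ∑∑-+ f g F G = trans (∑-cong (λ x → ∑-+ (f x) (g x) F) G) (∑-+ _ _ G)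

  ∑∑-cong : ∀ {f g : ℕ × ℕ → Monomial × Monomial → ℕ} → (∀ x y → f x y ≡ g x y) → ∀ F G →
    ∑ (λ x → ∑ (f x) F) G ≡ ∑ (λ x → ∑ (g x) F) G
  ∑∑-cong eq F = ∑-cong (λ x → ∑-cong (eq x) F)

  ∑-M-∷ : ∀ c n e γs → ∑ (M[_]at (n ∷ e)) (map (c ∷_) γs) ≡
    δ 0 n ℕ.* ∑ (M[_]at e) (map (c ∷_) γs) ℕ.+ δ (value c) n ℕ.* ∑ (M[_]at e) γs
  ∑-M-∷ c n e γs = begin
    ∑ (M[_]at (n ∷ e)) (map (c ∷_) γs)
      ≡⟨ ∑-map _ (c ∷_) γs ⟩
    ∑ (λ γ → δ 0 n ℕ.* M[ c ∷ γ ]at e ℕ.+ δ (value c) n ℕ.* M[ γ ]at e) γs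
      ≡⟨ ∑-+ _ _ γs ⟩
    ∑ (λ γ → δ 0 n ℕ.* M[ c ∷ γ ]at e) γs ℕ.+ ∑ (λ γ → δ (value c) n ℕ.* M[ γ ]at e) γs
      ≡⟨ cong₂ ℕ._+_ (∑-* (δ 0 n) _ γs) (∑-* (δ (value c) n) _ γs) ⟩
    δ 0 n ℕ.* ∑ (λ γ → M[ c ∷ γ ]at e) γs ℕ.+ δ (value c) n ℕ.* ∑ (M[_]at e) γs
      ≡⟨ cong (λ s → δ 0 n ℕ.* s ℕ.+ δ (value c) n ℕ.* ∑ (M[_]at e) γs)
           (sym (∑-map _ (c ∷_) γs)) ⟩
    δ 0 n ℕ.* ∑ (M[_]at e) (map (c ∷_) γs) ℕ.+ δ (value c) n ℕ.* ∑ (M[_]at e) γs ∎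
    where open ≡-Reasoning

⧢-correct : ∀ α β e →
  sum (map (M[_]at e) (α ⧢ β)) ≡
  sum (map (λ (u , v) → M[ α ]at u ℕ.* M[ β ]at v) (factorisations e))
⧢-correct []      []      []      = refl
⧢-correct []      (b ∷ β) []      = refl
⧢-correct (a ∷ α) []      []      = refl
⧢-correct (a ∷ α) (b ∷ β) []      = begin
  ∑ m (map (a ∷_) X ++ map (b ∷_) Y ++ map (_ ∷_) Z)
    ≡⟨ trans (∑-++ m (map (a ∷_) X) _) (cong (∑ m (map (a ∷_) X) ℕ.+_) (∑-++ m (map (b ∷_) Y) _)) ⟩
  ∑ m (map (a ∷_) X) ℕ.+ (∑ m (map (b ∷_) Y) ℕ.+ ∑ m (map (_ ∷_) Z))
    ≡⟨ cong₂ ℕ._+_ (vanish a X) (cong₂ ℕ._+_ (vanish b Y) (vanish _ Z)) ⟩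
  0 ∎
  where
  open ≡-Reasoning
  m = M[_]at []
  X = α ⧢ (b ∷ β)
  Y = (a ∷ α) ⧢ β
  Z = α ⧢ β
  vanish : ∀ c γs → ∑ m (map (c ∷_) γs) ≡ 0
  vanish c γs = trans (∑-map m (c ∷_) γs) (∑-* 0 (λ _ → 0) γs)
⧢-correct []      []      (n ∷ e) = begin
  δ 0 n ℕ.* M[ [] ]at e ℕ.+ 0
    ≡⟨ trans (+-identityʳ _) (cong (δ 0 n ℕ.*_) (trans (sym (+-identityʳ _)) (⧢-correct [] [] e))) ⟩
  δ 0 n ℕ.* cauchy M[ [] ]at_ M[ [] ]at_ e
    ≡⟨ sym (∑-block 0 0 _ _ n e) ⟩
  _ ≡⟨ sym (cauchy-∷ M[ [] ]at_ M[ [] ]at_ n e) ⟩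
  cauchy M[ [] ]at_ M[ [] ]at_ (n ∷ e) ∎
  where open ≡-Reasoning
⧢-correct [] (b ∷ β) (n ∷ e) = begin
  δ 0 n ℕ.* M[ b ∷ β ]at e ℕ.+ δ (value b) n ℕ.* M[ β ]at e ℕ.+ 0
    ≡⟨ +-identityʳ _ ⟩
  δ 0 n ℕ.* M[ b ∷ β ]at e ℕ.+ δ (value b) n ℕ.* M[ β ]at e
    ≡⟨ cong₂ (λ s t → δ 0 n ℕ.* s ℕ.+ δ (value b) n ℕ.* t)
         (trans (sym (+-identityʳ _)) (⧢-correct [] (b ∷ β) e))
         (trans (sym (+-identityʳ _)) (⧢-correct [] β e)) ⟩
  δ 0 n ℕ.* cauchy M[ [] ]at_ M[ b ∷ β ]at_ e ℕ.+
  δ (value b) n ℕ.* cauchy M[ [] ]at_ M[ β ]at_ e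
    ≡⟨ sym (cong₂ ℕ._+_ (∑-block 0 0 _ _ n e) (∑-block 0 (value b) _ _ n e)) ⟩
  _ ≡⟨ sym (∑∑-+ _ _ (factorisations e) (splitℕ n)) ⟩
  _ ≡⟨ ∑∑-cong (λ (i , j) (u , v) → sym (*-distribˡ-+ (δ 0 i ℕ.* M[ [] ]at u) _ _))
         (factorisations e) (splitℕ n) ⟩
  _ ≡⟨ sym (cauchy-∷ M[ [] ]at_ M[ b ∷ β ]at_ n e) ⟩
  cauchy M[ [] ]at_ M[ b ∷ β ]at_ (n ∷ e) ∎
  where open ≡-Reasoning
⧢-correct (a ∷ α) [] (n ∷ e) = begin
  δ 0 n ℕ.* M[ a ∷ α ]at e ℕ.+ δ (value a) n ℕ.* M[ α ]at e ℕ.+ 0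
    ≡⟨ +-identityʳ _ ⟩
  δ 0 n ℕ.* M[ a ∷ α ]at e ℕ.+ δ (value a) n ℕ.* M[ α ]at e
    ≡⟨ cong₂ (λ s t → δ 0 n ℕ.* s ℕ.+ δ (value a) n ℕ.* t)
         (trans (sym (+-identityʳ _)) (⧢-correct (a ∷ α) [] e))
         (trans (unit α) (⧢-correct α [] e)) ⟩
  δ 0 n ℕ.* cauchy M[ a ∷ α ]at_ M[ [] ]at_ e ℕ.+
  δ (value a) n ℕ.* cauchy M[ α ]at_ M[ [] ]at_ e
    ≡⟨ cong (λ k → δ 0 n ℕ.* cauchy M[ a ∷ α ]at_ M[ [] ]at_ e ℕ.+
                   δ k n ℕ.* cauchy M[ α ]at_ M[ [] ]at_ e) (sym (+-identityʳ (value a))) ⟩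
  _ ≡⟨ sym (cong₂ ℕ._+_ (∑-block 0 0 M[ a ∷ α ]at_ M[ [] ]at_ n e)
                         (∑-block (value a) 0 M[ α ]at_ M[ [] ]at_ n e)) ⟩
  _ ≡⟨ sym (∑∑-+ _ _ (factorisations e) (splitℕ n)) ⟩
  _ ≡⟨ ∑∑-cong (λ (i , j) (u , v) → sym (*-distribʳ-+ (δ 0 j ℕ.* M[ [] ]at v)
           (δ 0 i ℕ.* M[ a ∷ α ]at u) (δ (value a) i ℕ.* M[ α ]at u)))
         (factorisations e) (splitℕ n) ⟩
  _ ≡⟨ sym (cauchy-∷ M[ a ∷ α ]at_ M[ [] ]at_ n e) ⟩
  cauchy M[ a ∷ α ]at_ M[ [] ]at_ (n ∷ e) ∎
  where
  open ≡-Reasoning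
  unit : ∀ γ → M[ γ ]at e ≡ ∑ (M[_]at e) (γ ⧢ [])
  unit []      = sym (+-identityʳ _)
  unit (c ∷ γ) = sym (+-identityʳ _)
⧢-correct (a ∷ α) (b ∷ β) (n ∷ e) = begin
  ∑ m (A ++ B ++ D)
    ≡⟨ trans (∑-++ m A _) (cong (∑ m A ℕ.+_) (∑-++ m B D)) ⟩
  ∑ m A ℕ.+ (∑ m B ℕ.+ ∑ m D)
    ≡⟨ cong₂ ℕ._+_ (∑-M-∷ a n e (α ⧢ (b ∷ β)))
         (cong₂ ℕ._+_ (∑-M-∷ b n e ((a ∷ α) ⧢ β)) (∑-M-∷ (a +⁺ b) n e (α ⧢ β))) ⟩
  (δ₀ ℕ.* ∑ m′ A ℕ.+ δa ℕ.* ∑ m′ (α ⧢ (b ∷ β))) ℕ.+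
  ((δ₀ ℕ.* ∑ m′ B ℕ.+ δb ℕ.* ∑ m′ ((a ∷ α) ⧢ β)) ℕ.+
   (δ₀ ℕ.* ∑ m′ D ℕ.+ δab ℕ.* ∑ m′ (α ⧢ β)))
    ≡⟨ solve 10 (λ z p q r x y w s t k →
         (z :* p :+ x :* s) :+ ((z :* q :+ y :* t) :+ (z :* r :+ w :* k)) :=
         (z :* (p :+ (q :+ r)) :+ y :* t) :+ (x :* s :+ w :* k)) refl
         δ₀ (∑ m′ A) (∑ m′ B) (∑ m′ D) δa δb δab
         (∑ m′ (α ⧢ (b ∷ β))) (∑ m′ ((a ∷ α) ⧢ β)) (∑ m′ (α ⧢ β)) ⟩
  (δ₀ ℕ.* (∑ m′ A ℕ.+ (∑ m′ B ℕ.+ ∑ m′ D)) ℕ.+ δb ℕ.* ∑ m′ ((a ∷ α) ⧢ β)) ℕ.+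
  (δa ℕ.* ∑ m′ (α ⧢ (b ∷ β)) ℕ.+ δab ℕ.* ∑ m′ (α ⧢ β))
    ≡⟨ cong₂ ℕ._+_
         (cong₂ (λ s t → δ₀ ℕ.* s ℕ.+ δb ℕ.* t)
           (trans (sym (trans (∑-++ m′ A _) (cong (∑ m′ A ℕ.+_) (∑-++ m′ B D))))
                  (⧢-correct (a ∷ α) (b ∷ β) e))
           (⧢-correct (a ∷ α) β e))
         (cong₂ (λ s t → δa ℕ.* s ℕ.+ δab ℕ.* t)
           (⧢-correct α (b ∷ β) e) (⧢-correct α β e)) ⟩
  (δ₀ ℕ.* cauchy M[ a ∷ α ]at_ M[ b ∷ β ]at_ e ℕ.+ δb ℕ.* cauchy M[ a ∷ α ]at_ M[ β ]at_ e) ℕ.+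
  (δa ℕ.* cauchy M[ α ]at_ M[ b ∷ β ]at_ e ℕ.+ δab ℕ.* cauchy M[ α ]at_ M[ β ]at_ e)
    ≡⟨ cong (λ k → (δ₀ ℕ.* cauchy M[ a ∷ α ]at_ M[ b ∷ β ]at_ e ℕ.+
                    δb ℕ.* cauchy M[ a ∷ α ]at_ M[ β ]at_ e) ℕ.+
                   (δ k n ℕ.* cauchy M[ α ]at_ M[ b ∷ β ]at_ e ℕ.+
                    δab ℕ.* cauchy M[ α ]at_ M[ β ]at_ e)) (sym (+-identityʳ (value a))) ⟩
  _ ≡⟨ sym (cong₂ ℕ._+_
         (cong₂ ℕ._+_ (∑-block 0 0 _ _ n e) (∑-block 0 (value b) _ _ n e))
         (cong₂ ℕ._+_ (∑-block (value a) 0 _ _ n e) (∑-block (value a) (value b) _ _ n e))) ⟩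
  _ ≡⟨ sym (trans (∑∑-+ _ _ F G) (cong₂ ℕ._+_ (∑∑-+ _ _ F G) (∑∑-+ _ _ F G))) ⟩
  _ ≡⟨ ∑∑-cong (λ (i , j) (u , v) → expand
         (δ 0 i ℕ.* M[ a ∷ α ]at u) (δ (value a) i ℕ.* M[ α ]at u)
         (δ 0 j ℕ.* M[ b ∷ β ]at v) (δ (value b) j ℕ.* M[ β ]at v)) F G ⟩
  _ ≡⟨ sym (cauchy-∷ M[ a ∷ α ]at_ M[ b ∷ β ]at_ n e) ⟩
  cauchy M[ a ∷ α ]at_ M[ b ∷ β ]at_ (n ∷ e) ∎
  where
  open ≡-Reasoning
  open +-*-Solver
  m  = M[_]at (n ∷ e)
  m′ = M[_]at e
  F  = factorisations e
  G  = splitℕ n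
  δ₀ = δ 0 n
  δa = δ (value a) n
  δb = δ (value b) n
  δab = δ (value a ℕ.+ value b) n
  A = map (a ∷_) (α ⧢ (b ∷ β))
  B = map (b ∷_) ((a ∷ α) ⧢ β)
  D = map ((a +⁺ b) ∷_) (α ⧢ β)
  expand : ∀ p q r s →
    (p ℕ.* r ℕ.+ p ℕ.* s) ℕ.+ (q ℕ.* r ℕ.+ q ℕ.* s) ≡ (p ℕ.+ q) ℕ.* (r ℕ.+ s)
  expand = solve 4 (λ p q r s →
    (p :* r :+ p :* s) :+ (q :* r :+ q :* s) := (p :+ q) :* (r :+ s)) refl

module QuasiSymmetric {c ℓ} (R : CommutativeRing c ℓ) where

  open CommutativeRing R
  open RawSemiringDefs (RawRing.rawSemiring rawRing) using (_^_)
    renaming (_×_ to _·_)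

  ∑ᴿ : ∀ {a} {A : Set a} → (A → Carrier) → List A → Carrier
  ∑ᴿ h = foldr (λ x s → h x + s) 0#

  -- A list of pairs (c , α) stands for the finite sum Σ c M_α.
  QSym : Set c
  QSym = List (Carrier × Composition)

  M : Composition → QSym
  M α = [ (1# , α) ]

  coeff : QSym → Monomial → Carrier
  coeff f e = ∑ᴿ (λ (c , α) → c * ((M[ α ]at e) · 1#)) f

  -- Equality as power series.
  infix 4 _≈Q_
  _≈Q_ : QSym → QSym → Set ℓ
  f ≈Q g = ∀ e → coeff f e ≈ coeff g e

  infixr 7 _*ₗ_
  _*ₗ_ : Carrier → QSym → QSym
  c *ₗ f = map (map₁ (c *_)) f

  infixl 7 _*Q_
  _*Q_ : QSym → QSym → QSym
  f *Q g = concatMap (λ (c , α) → concatMap (λ (d , β) →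
             map (λ γ → c * d , γ) (α ⧢ β)) g) f

  QSym-rawRing : RawRing c ℓ
  QSym-rawRing = record
    { Carrier = QSym
    ; _≈_     = _≈Q_
    ; _+_     = _++_
    ; _*_     = _*Q_
    ; -_      = (- 1#) *ₗ_
    ; 0#      = []
    ; 1#      = M []
    }

  -- A triple (c , β , γ) stands for c M_β ⊗ M_γ.
  QSym⊗QSym : Set c
  QSym⊗QSym = List (Carrier × Composition × Composition)

  Δ : QSym → QSym⊗QSym
  Δ f = concatMap (λ (c , α) → map (c ,_) (deconcat α)) f

  Functional : Set c
  Functional = QSym → Carrier

  infix 4 _≐_
  _≐_ : Functional → Functional → Set (c ⊔ ℓ)
  ρ ≐ ψ = ∀ f → ρ f ≈ ψ f

  ε : Functional
  ε f = coeff f []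

  -- m ∘ (ρ ⊗ ψ) ∘ Δ; the values on the basis determine ρ ⊗ ψ since ρ and ψ
  -- are linear wherever this is used.
  infixl 7 _∗_
  _∗_ : Functional → Functional → Functional
  (ρ ∗ ψ) f = ∑ᴿ (λ (c , β , γ) → c * (ρ (M β) * ψ (M γ))) (Δ f)

  record IsCharacter (φ : Functional) : Set (c ⊔ ℓ) where
    open RingMorphisms QSym-rawRing rawRing using (IsRingHomomorphism)
    field
      isRingHomomorphism : IsRingHomomorphism φ
      *ₗ-homo            : ∀ c f → φ (c *ₗ f) ≈ c * φ f

  IsInverse : Functional → Functional → Set (c ⊔ ℓ)
  IsInverse φ ψ = (φ ∗ ψ ≐ ε) × (ψ ∗ φ ≐ ε)

  -- φ̄ (h) = (-1)ⁿ φ (h) for h homogeneous of degree n.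
  bar : Functional → Functional
  bar φ f = φ (map (λ (c , α) → (- 1#) ^ size α * c , α) f)

  IsEven : Functional → Set (c ⊔ ℓ)
  IsEven φ = bar φ ≐ φ

  IsOdd : Functional → Set (c ⊔ ℓ)
  IsOdd φ = IsInverse φ (bar φ)

  record IsEvenOddFactorisation (φ φ₊ φ₋ : Functional) : Set (c ⊔ ℓ) where
    field
      φ₊-isCharacter : IsCharacter φ₊
      φ₋-isCharacter : IsCharacter φ₋
      φ₊-isEven      : IsEven φ₊
      φ₋-isOdd       : IsOdd φ₋
      factors        : φ ≐ φ₊ ∗ φ₋

  -- The universal character f ↦ f(1, 0, 0, …).
  ζ : Functional
  ζ f = ∑ᴿ (λ (c , α) → c * ζM α) f
    where
    ζM : Composition → Carrier
    ζM []          = 1#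
    ζM (_ ∷ [])    = 1#
    ζM (_ ∷ _ ∷ _) = 0#

-- The division by p! (p+q)! q! is always exact, so truncation plays no role.
C : ℕ → ℕ → ℕ
C p q = ((2 ℕ.* p) ! ℕ.* (2 ℕ.* q) !) / (p ! ℕ.* (p ℕ.+ q) ! ℕ.* q !)
  where instance
    _ = m*n≢0 (p ! ℕ.* (p ℕ.+ q) !) (q !)
          {{m*n≢0 (p !) ((p ℕ.+ q) !) {{p !≢0}} {{(p ℕ.+ q) !≢0}}}} {{q !≢0}}

HeytingField⇒CommutativeRing : ∀ {c ℓ₁ ℓ₂} → HeytingField c ℓ₁ ℓ₂ → CommutativeRing c ℓ₁
HeytingField⇒CommutativeRing K = HeytingCommutativeRing.commutativeRing heytingCommutativeRing
  where open HeytingField K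

-- Apartness is the constructive form of inequality in a field.
Char≠2 : ∀ {c ℓ₁ ℓ₂} → HeytingField c ℓ₁ ℓ₂ → Set ℓ₂
Char≠2 K = 1# + 1# # 0#
  where open HeytingField K

module Values {c ℓ₁ ℓ₂} (K : HeytingField c ℓ₁ ℓ₂) (2#0 : Char≠2 K) where

  open HeytingField K
  open RawSemiringDefs
    (RawRing.rawSemiring (CommutativeRing.rawRing (HeytingField⇒CommutativeRing K)))
    using (_^_) renaming (_×_ to _·_)

  -- #⇒invertible inverts the difference (1# + 1#) - 0#.
  ½ : Carrier
  ½ = proj₁ (#⇒invertible 2#0)

  infixl 7 _/2^_
  _/2^_ : Carrier → ℕ → Carrier
  x /2^ m = x * ½ ^ m

  -- The case distinction on a₁ does not apply to the empty composition, where
  -- a character takes the value 1; the formula for odd a₁ also gives 1 there.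
  ζ⁻¹₋-value : Composition → Carrier
  ζ⁻¹₋-value []         = 1#
  ζ⁻¹₋-value α@(a₁ ∷ _) =
    if does (2 ∣? value a₁)
    then 0#
    else (- 1#) ^ length α /2^ (2 ℕ.* h) * (C 0 h · 1#)
    where h = ⌊ kₒ α /2⌋

  -- For n even kₒ α is even, so that ⌊ kₒ α /2⌋ is exactly half of it.
  ζ⁻¹₊-value : ℕ → Composition → Carrier
  ζ⁻¹₊-value n α =
    if does (2 ∣? n)
    then (- 1#) ^ length α /2^ kₒ α * (C 0 ⌊ kₒ α /2⌋ · 1#)
    else 0#

{-# OPTIONS --safe #-}
-- Write ρ ⋆ ψ for convolution on the basis M_α. A factorisation φ = φ₊ φ₋ is
-- determined, by induction on the length of α, by φ₊ ⋆ φ₋ = φ, φ₋ ⋆ φ̄₋ = ε and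
-- the vanishing of φ₊ in odd degree. So it is enough that the claimed values
-- satisfy these equations for φ = ζ⁻¹, i.e. φ(M_α) = (-1)^k(α). Only the parts
-- of α that are odd matter, and both equations reduce to convolutions of
-- sequences indexed by the number of odd parts; with b_j = C(0,j) / 4^j they
-- follow from Σ b_j b_{n-j} = 1, which is Σ C(2j,j) C(2(n-j),n-j) = 4^n.
module Submission where

open import Defs
open import Algebra.Apartness.Bundles using (HeytingField)
open import Algebra.Bundles using (CommutativeRing; CommutativeSemiring)
open import Algebra.Morphism.Structures using (module RingMorphisms)
import Algebra.Properties.AbelianGroup as AbelianGroupProperties
import Algebra.Properties.Ring as RingProperties
import Algebra.Properties.Semiring.Exp as SemiringExp
import Algebra.Properties.Semiring.Mult as SemiringMult
import Algebra.Solver.Ring.NaturalCoefficients.Default as SemiringSolver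
open import Data.Bool.Base using (Bool; true; false; not; if_then_else_)
open import Data.List.Base using ([]; _∷_; _++_; map; length)
open import Data.Nat.Base
  using (ℕ; zero; suc; NonZero; _<_; _≤_; z≤n; s≤s; s<s; z<s; _!; ⌊_/2⌋)
import Data.Nat.Base as Nat
open import Data.Nat.Combinatorics using (k![n∸k]!∣n!)
open import Data.Nat.Divisibility using (_∣_; _∣?_)
open import Data.Nat.DivMod using (m/n*n≡m)
import Data.Nat.Properties as ℕ
open import Data.Nat.Solver using (module +-*-Solver)
open import Data.Product.Base using (_×_; _,_; proj₁; proj₂; map₁)
open import Function.Base using (_∘_)
open import Level using (_⊔_)
open import Relation.Binary.PropositionalEquality as ≡ using (_≡_)
import Relation.Binary.Reasoning.Setoid as SetoidReasoning
open import Relation.Nullary.Decidable using (does)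

-- Cauchy products of sequences over a commutative semiring.

module Convolution {c ℓ} (S : CommutativeSemiring c ℓ) where

  open CommutativeSemiring S
  open SemiringSolver S
  open SetoidReasoning setoid

  Sequence : Set c
  Sequence = ℕ → Carrier

  infixl 7 _⊛_
  -- The recursion peels off the term with left index 0 and shifts the left factor. `_⋆_` below
  -- recurses in the same way, so sums over compositions can be matched with it term by term.
  _⊛_ : Sequence → Sequence → Sequence
  (f ⊛ g) zero    = f 0 * g 0
  (f ⊛ g) (suc n) = f 0 * g (suc n) + ((f ∘ suc) ⊛ g) n

  ⊛-cong : ∀ {f f′ g g′} → (∀ i → f i ≈ f′ i) → (∀ i → g i ≈ g′ i) →
           ∀ n → (f ⊛ g) n ≈ (f′ ⊛ g′) n
  ⊛-cong f≈ g≈ zero    = *-cong (f≈ 0) (g≈ 0)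
  ⊛-cong f≈ g≈ (suc n) = +-cong (*-cong (f≈ 0) (g≈ (suc n))) (⊛-cong (f≈ ∘ suc) g≈ n)

  ⊛-linearˡ : ∀ a b f g h n →
    ((λ i → a * f i + b * g i) ⊛ h) n ≈ a * (f ⊛ h) n + b * (g ⊛ h) n
  ⊛-linearˡ a b f g h zero    =
    solve 5 (λ a b x y z → (a :* x :+ b :* y) :* z := a :* (x :* z) :+ b :* (y :* z)) refl
      a b (f 0) (g 0) (h 0)
  ⊛-linearˡ a b f g h (suc n) = trans
    (+-congˡ (⊛-linearˡ a b (f ∘ suc) (g ∘ suc) h n))
    (solve 7 (λ a b x y z u v →
      (a :* x :+ b :* y) :* z :+ (a :* u :+ b :* v) :=
      a :* (x :* z :+ u) :+ b :* (y :* z :+ v)) refl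
      a b (f 0) (g 0) (h (suc n)) (((f ∘ suc) ⊛ h) n) (((g ∘ suc) ⊛ h) n))

  -- Peels off the term at the opposite end from the defining recursion; commutativity follows by
  -- playing the two expansions against each other.
  ⊛-suc : ∀ f g n → (f ⊛ g) (suc n) ≈ (f ⊛ (g ∘ suc)) n + f (suc n) * g 0
  ⊛-suc f g zero    = refl
  ⊛-suc f g (suc n) = trans (+-congˡ (⊛-suc (f ∘ suc) g n)) (sym (+-assoc _ _ _))

  ⊛-comm : ∀ f g n → (f ⊛ g) n ≈ (g ⊛ f) n
  ⊛-comm f g zero    = *-comm (f 0) (g 0)
  ⊛-comm f g (suc n) = begin
    f 0 * g (suc n) + ((f ∘ suc) ⊛ g) n  ≈⟨ +-cong (*-comm _ _) (⊛-comm (f ∘ suc) g n) ⟩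
    g (suc n) * f 0 + (g ⊛ (f ∘ suc)) n  ≈⟨ +-comm _ _ ⟩
    (g ⊛ (f ∘ suc)) n + g (suc n) * f 0  ≈⟨ ⊛-suc g f n ⟨
    (g ⊛ f) (suc n)                      ∎

-- Self-convolution of the central binomial coefficients.

module CentralBinomial where

  open Convolution ℕ.+-*-commutativeSemiring
  open Nat using (_+_; _*_; _^_; _∸_)
  open ≡ using (refl; sym; trans; cong; cong₂; subst₂)
  open ≡.≡-Reasoning
  open +-*-Solver

  weighted : Sequence → Sequence
  weighted f i = i * f i

  -- `weighted` is the Euler operator x d/dx on generating functions, and this is its Leibniz rule.
  ⊛-derivation : ∀ f g n → (weighted f ⊛ g) n + (f ⊛ weighted g) n ≡ n * (f ⊛ g) n
  ⊛-derivation f g zero    = ℕ.*-zeroʳ (f 0)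
  ⊛-derivation f g (suc n) = begin
    (weighted f ∘ suc ⊛ g) n + (f 0 * (suc n * g (suc n)) + (f ∘ suc ⊛ weighted g) n)
      -- The weight `suc i` is split as 1 + i, with explicit factors 1 to match the shape of
      -- `⊛-linearˡ`.
      ≡⟨ cong (_+ (f 0 * (suc n * g (suc n)) + (f ∘ suc ⊛ weighted g) n)) (trans
           (⊛-cong {g = g}
             (λ i → cong₂ _+_ (sym (ℕ.*-identityˡ (f (suc i)))) (sym (ℕ.*-identityˡ (i * f (suc i)))))
             (λ _ → refl) n)
           (⊛-linearˡ 1 1 (f ∘ suc) (weighted (f ∘ suc)) g n)) ⟩
    1 * S + 1 * D + (f 0 * (suc n * g (suc n)) + E)
      ≡⟨ solve 6 (λ n x y s d e →
           con 1 :* s :+ con 1 :* d :+ (x :* ((con 1 :+ n) :* y) :+ e) :=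
           (d :+ e) :+ (s :+ (con 1 :+ n) :* (x :* y))) refl n (f 0) (g (suc n)) S D E ⟩
    (D + E) + (S + suc n * (f 0 * g (suc n)))
      ≡⟨ cong (_+ (S + suc n * (f 0 * g (suc n)))) (⊛-derivation (f ∘ suc) g n) ⟩
    n * S + (S + suc n * (f 0 * g (suc n)))
      ≡⟨ solve 3 (λ n s p →
           n :* s :+ (s :+ (con 1 :+ n) :* p) := (con 1 :+ n) :* (p :+ s)) refl
           n S (f 0 * g (suc n)) ⟩
    suc n * (f 0 * g (suc n) + S) ∎
    where
    S = (f ∘ suc ⊛ g) n
    D = (weighted (f ∘ suc) ⊛ g) n
    E = (f ∘ suc ⊛ weighted g) n

  central : ℕ → ℕ
  central = C 0

  k!k!≢0 : ∀ n → NonZero (n ! * n !)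
  k!k!≢0 n = ℕ.m*n≢0 (n !) (n !) {{n ℕ.!≢0}} {{n ℕ.!≢0}}

  -- The division in `C 0 n` is exact because k! (m - k)! divides m!, taken at m = 2n and k = n. The
  -- stray factors 1 are the values of `0 !` in `C`.
  central-factorial : ∀ n → central n * (n ! * n !) ≡ (2 * n) !
  central-factorial n = begin
    central n * (n ! * n !)
      ≡⟨ cong (central n *_) (cong (_* n !) (sym (ℕ.*-identityˡ (n !)))) ⟩
    central n * (1 * n ! * n !)
      ≡⟨ m/n*n≡m {{ℕ.m*n≢0 (1 * n !) (n !) {{ℕ.m*n≢0 1 (n !) {{_}} {{n ℕ.!≢0}}}} {{n ℕ.!≢0}}}} divides ⟩
    1 * (2 * n) !
      ≡⟨ ℕ.*-identityˡ _ ⟩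
    (2 * n) ! ∎
    where
    2n∸n≡n : 2 * n ∸ n ≡ n
    2n∸n≡n = trans (ℕ.m+n∸m≡n n (n + 0)) (ℕ.+-identityʳ n)
    divides : 1 * n ! * n ! ∣ 1 * (2 * n) !
    divides = subst₂ _∣_
      (trans (cong (λ m → n ! * m !) 2n∸n≡n) (cong (_* n !) (sym (ℕ.*-identityˡ (n !)))))
      (sym (ℕ.*-identityˡ ((2 * n) !)))
      (k![n∸k]!∣n! (ℕ.m≤m+n n (n + 0)))

  -- Obtained by clearing factorials. The factor 4n + 2 is split so that `⊛-linearˡ` applies with
  -- `weighted central` and `central`.
  central-suc : ∀ n → suc n * central (suc n) ≡ 4 * (n * central n) + 2 * central n
  central-suc n = ℕ.*-cancelʳ-≡ _ _ (suc n ! * suc n !) {{k!k!≢0 (suc n)}} (begin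
    suc n * central (suc n) * (suc n ! * suc n !)
      ≡⟨ ℕ.*-assoc (suc n) (central (suc n)) _ ⟩
    suc n * (central (suc n) * (suc n ! * suc n !))
      ≡⟨ cong (suc n *_) (central-factorial (suc n)) ⟩
    suc n * (2 * suc n) !
      ≡⟨ cong (λ m → suc n * m !) (ℕ.*-suc 2 n) ⟩
    suc n * ((2 + 2 * n) * ((1 + 2 * n) * (2 * n) !))
      ≡⟨ cong (λ m → suc n * ((2 + 2 * n) * ((1 + 2 * n) * m))) (sym (central-factorial n)) ⟩
    suc n * ((2 + 2 * n) * ((1 + 2 * n) * (central n * (n ! * n !))))
      ≡⟨ solve 3 (λ n c f →
           (con 1 :+ n) :* ((con 2 :+ con 2 :* n) :* ((con 1 :+ con 2 :* n) :* (c :* (f :* f)))) :=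
           (con 4 :* (n :* c) :+ con 2 :* c) :* ((f :+ n :* f) :* (f :+ n :* f))) refl
           n (central n) (n !) ⟩
    (4 * (n * central n) + 2 * central n) * (suc n ! * suc n !) ∎)

  -- With S n = Σ c_j c_{n-j} and D n = Σ j c_j c_{n-j}, symmetry gives 2 D n = n S n
  -- and the recurrence for c gives D (n+1) = 4 D n + 2 S n.
  central⊛central-suc : ∀ n → (central ⊛ central) (suc n) ≡ 4 * (central ⊛ central) n
  central⊛central-suc n = ℕ.*-cancelˡ-≡ _ _ (suc n) (begin
    suc n * S (suc n)
      ≡⟨ 2D≡nS (suc n) ⟨
    2 * D (suc n)
      ≡⟨ cong (2 *_) (trans
           (⊛-cong {g = central} central-suc (λ _ → refl) n)
           (⊛-linearˡ 4 2 (weighted central) central central n)) ⟩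
    2 * (4 * D n + 2 * S n)
      ≡⟨ solve 2 (λ d s → con 2 :* (con 4 :* d :+ con 2 :* s) :=
           con 4 :* (con 2 :* d :+ s)) refl (D n) (S n) ⟩
    4 * (2 * D n + S n)
      ≡⟨ cong (λ m → 4 * (m + S n)) (2D≡nS n) ⟩
    4 * (n * S n + S n)
      ≡⟨ solve 2 (λ n s → con 4 :* (n :* s :+ s) := (con 1 :+ n) :* (con 4 :* s)) refl n (S n) ⟩
    suc n * (4 * S n) ∎)
    where
    S D : ℕ → ℕ
    S = central ⊛ central
    D = weighted central ⊛ central
    2D≡nS : ∀ m → 2 * D m ≡ m * S m
    2D≡nS m = begin
      2 * D m
        ≡⟨ cong (D m +_) (trans (ℕ.+-identityʳ (D m)) (⊛-comm (weighted central) central m)) ⟩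
      D m + (central ⊛ weighted central) m
        ≡⟨ ⊛-derivation central central m ⟩
      m * S m ∎

  central⊛central : ∀ n → (central ⊛ central) n ≡ 4 ^ n
  central⊛central zero    = refl
  central⊛central (suc n) = trans (central⊛central-suc n) (cong (4 *_) (central⊛central n))

open CentralBinomial using (central; central⊛central)
open Convolution ℕ.+-*-commutativeSemiring using () renaming (_⊛_ to _⊛ℕ_)

-- Parity of the degree and of the number of odd parts.

isEven : ℕ → Bool
isEven n = does (2 ∣? n)

isEven-suc : ∀ n → isEven (suc n) ≡ not (isEven n)
isEven-suc zero          = ≡.refl
isEven-suc (suc zero)    = ≡.refl
isEven-suc (suc (suc n)) = isEven-suc n

isEven-+ : ∀ m n → isEven (m Nat.+ n) ≡ (if isEven m then isEven n else not (isEven n))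
isEven-+ zero          n = ≡.refl
isEven-+ (suc zero)    n = isEven-suc n
isEven-+ (suc (suc m)) n = isEven-+ m n

isEven⇒n≡2*⌊n/2⌋ : ∀ n → isEven n ≡ true → n ≡ 2 Nat.* ⌊ n /2⌋
isEven⇒n≡2*⌊n/2⌋ zero          _ = ≡.refl
isEven⇒n≡2*⌊n/2⌋ (suc (suc n)) p =
  ≡.trans (≡.cong (2 Nat.+_) (isEven⇒n≡2*⌊n/2⌋ n p)) (≡.sym (ℕ.*-suc 2 ⌊ n /2⌋))

kₒ-∷ : ∀ a α → kₒ (a ∷ α) ≡ (if isEven (value a) then kₒ α else suc (kₒ α))
kₒ-∷ a α with isEven (value a)
... | true  = ≡.refl
... | false = ≡.refl

isEven-size : ∀ α → isEven (size α) ≡ isEven (kₒ α)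
isEven-size []      = ≡.refl
isEven-size (a ∷ α) rewrite isEven-+ (value a) (size α) | kₒ-∷ a α with isEven (value a)
... | true  = isEven-size α
... | false = ≡.trans (≡.cong not (isEven-size α)) (≡.sym (isEven-suc (kₒ α)))

module EvenOdd {c ℓ} (R : CommutativeRing c ℓ) where

  open CommutativeRing R
  open QuasiSymmetric R
  open Convolution commutativeSemiring public
  open SemiringExp semiring
  open SemiringMult semiring using (×-homo-+; ×1-homo-*) renaming (_×_ to _·_)
  open RingProperties ring using (-1*x≈-x; -‿involutive)
  open AbelianGroupProperties +-abelianGroup using ()
    renaming (∙-cancelˡ to +-cancelˡ; ∙-cancelʳ to +-cancelʳ; inverseˡ-unique to +-inverseˡ-unique)
  open SemiringSolver commutativeSemiring
  open SetoidReasoning setoid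

  -- Signs.

  sgn : ℕ → Carrier
  sgn n = (- 1#) ^ n

  -1*-1≈1 : - 1# * - 1# ≈ 1#
  -1*-1≈1 = trans (-1*x≈-x (- 1#)) (-‿involutive 1#)

  sgn-2+ : ∀ n → sgn (2 Nat.+ n) ≈ sgn n
  sgn-2+ n = begin
    - 1# * (- 1# * sgn n)  ≈⟨ *-assoc _ _ _ ⟨
    (- 1# * - 1#) * sgn n  ≈⟨ *-congʳ -1*-1≈1 ⟩
    1# * sgn n             ≈⟨ *-identityˡ _ ⟩
    sgn n                  ∎

  sgn-isEven : ∀ n → sgn n ≈ (if isEven n then 1# else - 1#)
  sgn-isEven zero          = refl
  sgn-isEven (suc zero)    = *-identityʳ _
  sgn-isEven (suc (suc n)) = trans (sgn-2+ n) (sgn-isEven n)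

  sgn-size : ∀ α → sgn (size α) ≈ sgn (kₒ α)
  sgn-size α = begin
    sgn (size α)                            ≈⟨ sgn-isEven (size α) ⟩
    (if isEven (size α) then 1# else - 1#)  ≡⟨ ≡.cong (if_then 1# else - 1#) (isEven-size α) ⟩
    (if isEven (kₒ α) then 1# else - 1#)    ≈⟨ sgn-isEven (kₒ α) ⟨
    sgn (kₒ α)                              ∎

  sgn-suc+sgn : ∀ n → sgn (suc n) + sgn n ≈ 0#
  sgn-suc+sgn n = trans (+-congʳ (-1*x≈-x (sgn n))) (-‿inverseˡ (sgn n))

  -- Sequences read through n / 2, that is, the substitution of x² in generating functions.

  evenPart : Sequence → Sequence
  evenPart f n = if isEven n then f ⌊ n /2⌋ else 0#

  -- `evenPart f` has generating function f(x²). As s has period two, the right factor is (s₀ + s₁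
  -- x) g(x²), so the product is (s₀ + s₁ x) (fg)(x²).
  evenPart-⊛ : ∀ (s : Sequence) → (∀ n → s (2 Nat.+ n) ≈ s n) → ∀ f g n →
    (evenPart f ⊛ (λ i → s i * g ⌊ i /2⌋)) n ≈ s n * (f ⊛ g) ⌊ n /2⌋
  evenPart-⊛ s per f g zero          =
    solve 3 (λ x s y → x :* (s :* y) := s :* (x :* y)) refl (f 0) (s 0) (g 0)
  evenPart-⊛ s per f g (suc zero)    =
    solve 4 (λ x s y t → x :* (s :* y) :+ con 0 :* (t :* y) := s :* (x :* y)) refl
      (f 0) (s 1) (g 0) (s 0)
  evenPart-⊛ s per f g (suc (suc n)) = begin
    f 0 * (s (2 Nat.+ n) * g (suc h)) +
      (0# * (s (suc n) * g ⌊ suc n /2⌋) + (evenPart (f ∘ suc) ⊛ (λ i → s i * g ⌊ i /2⌋)) n)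
      ≈⟨ +-congˡ (+-congˡ (trans (evenPart-⊛ s per (f ∘ suc) g n) (*-congʳ (sym (per n))))) ⟩
    f 0 * (s (2 Nat.+ n) * g (suc h)) +
      (0# * (s (suc n) * g ⌊ suc n /2⌋) + s (2 Nat.+ n) * ((f ∘ suc) ⊛ g) h)
      ≈⟨ solve 5 (λ x s y z w → x :* (s :* y) :+ (con 0 :* z :+ s :* w) := s :* (x :* y :+ w)) refl
           (f 0) (s (2 Nat.+ n)) (g (suc h)) (s (suc n) * g ⌊ suc n /2⌋) (((f ∘ suc) ⊛ g) h) ⟩
    s (2 Nat.+ n) * (f ⊛ g) (suc h) ∎
    where h = ⌊ n /2⌋

  delay : Sequence → Sequence
  delay f zero    = 0#
  delay f (suc n) = f n

  -- The generating function of the left side is (1 + x) f(x²), and `delay` is multiplication by x.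
  -- The factors `1#` fit `⊛-linearˡ`.
  halved-decomposition : ∀ f n → f ⌊ n /2⌋ ≈ 1# * evenPart f n + 1# * delay (evenPart f) n
  halved-decomposition f zero          =
    solve 1 (λ x → x := con 1 :* x :+ con 1 :* con 0) refl (f 0)
  halved-decomposition f (suc zero)    =
    solve 1 (λ x → x := con 1 :* con 0 :+ con 1 :* x) refl (f 0)
  halved-decomposition f (suc (suc n)) = trans
    (halved-decomposition (f ∘ suc) n)
    (+-congˡ (*-congˡ (reflexive (≡.sym (evenPart-suc n)))))
    where
    evenPart-suc : ∀ n → evenPart f (suc n) ≡ delay (evenPart (f ∘ suc)) n
    evenPart-suc zero    = ≡.refl
    evenPart-suc (suc n) = ≡.refl

  -- The factors are (1 + x) f(x²) and (1 - x) g(x²). The two summands come from the terms 1 and x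
  -- of 1 + x, multiplied by (1 - x) (fg)(x²).
  halved-⊛-alternating : ∀ f g n →
    ((λ i → f ⌊ i /2⌋) ⊛ (λ i → sgn i * g ⌊ i /2⌋)) (suc n) ≈
    sgn (suc n) * (f ⊛ g) ⌊ suc n /2⌋ + sgn n * (f ⊛ g) ⌊ n /2⌋
  halved-⊛-alternating f g n = begin
    ((λ i → f ⌊ i /2⌋) ⊛ w) (suc n)
      ≈⟨ ⊛-cong {g = w} (halved-decomposition f) (λ _ → refl) (suc n) ⟩
    ((λ i → 1# * evenPart f i + 1# * delay (evenPart f) i) ⊛ w) (suc n)
      ≈⟨ ⊛-linearˡ 1# 1# (evenPart f) (delay (evenPart f)) w (suc n) ⟩
    1# * (evenPart f ⊛ w) (suc n) + 1# * (0# * w (suc n) + (evenPart f ⊛ w) n)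
      ≈⟨ solve 3 (λ x y z → con 1 :* x :+ con 1 :* (con 0 :* y :+ z) := x :+ z) refl
           ((evenPart f ⊛ w) (suc n)) (w (suc n)) ((evenPart f ⊛ w) n) ⟩
    (evenPart f ⊛ w) (suc n) + (evenPart f ⊛ w) n
      ≈⟨ +-cong (evenPart-⊛ sgn sgn-2+ f g (suc n)) (evenPart-⊛ sgn sgn-2+ f g n) ⟩
    sgn (suc n) * (f ⊛ g) ⌊ suc n /2⌋ + sgn n * (f ⊛ g) ⌊ n /2⌋ ∎
    where w = λ i → sgn i * g ⌊ i /2⌋

  -- The substitution of qx for x is multiplicative.
  ⊛-geometric : ∀ q f g n → ((λ i → q ^ i * f i) ⊛ (λ i → q ^ i * g i)) n ≈ q ^ n * (f ⊛ g) n
  ⊛-geometric q f g zero    =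
    solve 2 (λ x y → (con 1 :* x) :* (con 1 :* y) := con 1 :* (x :* y)) refl (f 0) (g 0)
  ⊛-geometric q f g (suc n) = begin
    (1# * f 0) * (q ^ suc n * g (suc n)) + ((λ i → q ^ suc i * f (suc i)) ⊛ G) n
      -- The summand with coefficient 0 is padding for the two-term `⊛-linearˡ`.
      ≈⟨ +-congˡ (⊛-cong {g = G} (λ i → solve 3 (λ q r x →
           (q :* r) :* x := q :* (r :* x) :+ con 0 :* x) refl q (q ^ i) (f (suc i)))
           (λ _ → refl) n) ⟩
    (1# * f 0) * (q ^ suc n * g (suc n)) + ((λ i → q * (q ^ i * f (suc i)) + 0# * f (suc i)) ⊛ G) n
      ≈⟨ +-congˡ (⊛-linearˡ q 0# (λ i → q ^ i * f (suc i)) (f ∘ suc) G n) ⟩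
    (1# * f 0) * (q ^ suc n * g (suc n)) +
      (q * ((λ i → q ^ i * f (suc i)) ⊛ G) n + 0# * ((f ∘ suc) ⊛ G) n)
      ≈⟨ +-congˡ (+-congʳ (*-congˡ (⊛-geometric q (f ∘ suc) g n))) ⟩
    (1# * f 0) * (q ^ suc n * g (suc n)) + (q * (q ^ n * ((f ∘ suc) ⊛ g) n) + 0# * ((f ∘ suc) ⊛ G) n)
      ≈⟨ solve 6 (λ q r x y z w →
           (con 1 :* x) :* ((q :* r) :* y) :+ (q :* (r :* z) :+ con 0 :* w) :=
           (q :* r) :* (x :* y :+ z)) refl
           q (q ^ n) (f 0) (g (suc n)) (((f ∘ suc) ⊛ g) n) (((f ∘ suc) ⊛ G) n) ⟩
    q ^ suc n * (f ⊛ g) (suc n) ∎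
    where G = λ i → q ^ i * g i

  ⊛-homo-· : ∀ (f g : ℕ → ℕ) n →
    ((λ i → f i · 1#) ⊛ (λ i → g i · 1#)) n ≈ (f ⊛ℕ g) n · 1#
  ⊛-homo-· f g zero    = sym (×1-homo-* (f 0) (g 0))
  ⊛-homo-· f g (suc n) = trans
    (+-cong (sym (×1-homo-* (f 0) (g (suc n)))) (⊛-homo-· (f ∘ suc) g n))
    (sym (×-homo-+ 1# (f 0 Nat.* g (suc n)) _))

  -- Convolution of functions on the monomial basis.

  Series : Set c
  Series = Composition → Carrier

  counit : Series
  counit []      = 1#
  counit (_ ∷ _) = 0#

  infixl 7 _⋆_
  -- The sum over deconcatenations. Either the left piece is empty, or it starts with `a`, which the
  -- shift `f ∘ (a ∷_)` absorbs.
  _⋆_ : Series → Series → Series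
  (f ⋆ g) []      = f [] * g []
  (f ⋆ g) (a ∷ α) = f [] * g (a ∷ α) + ((f ∘ (a ∷_)) ⋆ g) α

  ⋆-cong : ∀ {f f′ g g′} → (∀ α → f α ≈ f′ α) → (∀ α → g α ≈ g′ α) → ∀ α →
           (f ⋆ g) α ≈ (f′ ⋆ g′) α
  ⋆-cong f≈ g≈ []      = *-cong (f≈ []) (g≈ [])
  ⋆-cong f≈ g≈ (a ∷ α) = +-cong (*-cong (f≈ []) (g≈ (a ∷ α))) (⋆-cong (f≈ ∘ (a ∷_)) g≈ α)

  ⋆-zeroˡ : ∀ {f} → (∀ α → f α ≈ 0#) → ∀ g α → (f ⋆ g) α ≈ 0#
  ⋆-zeroˡ f≈0 g []      = trans (*-congʳ (f≈0 [])) (zeroˡ _)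
  ⋆-zeroˡ f≈0 g (a ∷ α) = trans
    (+-cong (trans (*-congʳ (f≈0 [])) (zeroˡ _)) (⋆-zeroˡ (f≈0 ∘ (a ∷_)) g α))
    (+-identityˡ 0#)

  ⋆-identityˡ : ∀ {f} → (∀ α → f α ≈ counit α) → ∀ g α → (f ⋆ g) α ≈ g α
  ⋆-identityˡ f≈ g []      = trans (*-congʳ (f≈ [])) (*-identityˡ _)
  ⋆-identityˡ f≈ g (a ∷ α) = trans
    (+-cong (trans (*-congʳ (f≈ [])) (*-identityˡ _)) (⋆-zeroˡ (f≈ ∘ (a ∷_)) g α))
    (+-identityʳ _)

  ⋆-scaleˡ : ∀ x f g α → ((λ β → x * f β) ⋆ g) α ≈ x * (f ⋆ g) α
  ⋆-scaleˡ x f g []      = *-assoc _ _ _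
  ⋆-scaleˡ x f g (a ∷ α) =
    trans (+-cong (*-assoc _ _ _) (⋆-scaleˡ x (f ∘ (a ∷_)) g α)) (sym (distribˡ _ _ _))

  signed : Series → Series
  signed f α = sgn (length α) * f α

  -- Lengths add under deconcatenation, so the sign of α is the product of the signs of its two
  -- pieces.
  signed-⋆ : ∀ f g α → (signed f ⋆ signed g) α ≈ signed (f ⋆ g) α
  signed-⋆ f g []      =
    solve 2 (λ x y → (con 1 :* x) :* (con 1 :* y) := con 1 :* (x :* y)) refl (f []) (g [])
  signed-⋆ f g (a ∷ α) = begin
    (1# * f []) * (sgn (suc (length α)) * g (a ∷ α)) + ((signed f ∘ (a ∷_)) ⋆ signed g) α
      ≈⟨ +-congˡ (⋆-cong {g = signed g} (λ _ → *-assoc _ _ _) (λ _ → refl) α) ⟩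
    (1# * f []) * (sgn (suc (length α)) * g (a ∷ α)) +
      ((λ β → - 1# * signed (f ∘ (a ∷_)) β) ⋆ signed g) α
      ≈⟨ +-congˡ (trans (⋆-scaleˡ (- 1#) (signed (f ∘ (a ∷_))) (signed g) α)
           (*-congˡ (signed-⋆ (f ∘ (a ∷_)) g α))) ⟩
    (1# * f []) * (sgn (suc (length α)) * g (a ∷ α)) +
      - 1# * (sgn (length α) * ((f ∘ (a ∷_)) ⋆ g) α)
      ≈⟨ solve 5 (λ m s x y z → (con 1 :* x) :* ((m :* s) :* y) :+ m :* (s :* z) :=
           (m :* s) :* (x :* y :+ z)) refl
           (- 1#) (sgn (length α)) (f []) (g (a ∷ α)) (((f ∘ (a ∷_)) ⋆ g) α) ⟩
    signed (f ⋆ g) (a ∷ α) ∎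

  -- The final term of (f ⋆ g) α is f α * g [] ≈ f α; stated with f′ α and f α
  -- moved across so that no subtraction occurs.
  ⋆-exchangeˡ : ∀ {f f′ g g′} α →
    (∀ β → length β < length α → f β ≈ f′ β) → (∀ γ → length γ ≤ length α → g γ ≈ g′ γ) →
    g [] ≈ 1# → (f ⋆ g) α + f′ α ≈ (f′ ⋆ g′) α + f α
  ⋆-exchangeˡ {f} {f′} {g} {g′} [] f≈ g≈ g1 = begin
    f [] * g [] + f′ []   ≈⟨ +-congʳ (trans (*-congˡ g1) (*-identityʳ _)) ⟩
    f [] + f′ []          ≈⟨ +-comm _ _ ⟩
    f′ [] + f []          ≈⟨ +-congʳ (trans (*-congˡ (trans (sym (g≈ [] z≤n)) g1)) (*-identityʳ _)) ⟨
    f′ [] * g′ [] + f []  ∎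
  ⋆-exchangeˡ {f} {f′} {g} {g′} (a ∷ α) f≈ g≈ g1 = begin
    f [] * g (a ∷ α) + ((f ∘ (a ∷_)) ⋆ g) α + f′ (a ∷ α)
      ≈⟨ +-assoc _ _ _ ⟩
    f [] * g (a ∷ α) + (((f ∘ (a ∷_)) ⋆ g) α + f′ (a ∷ α))
      ≈⟨ +-cong (*-cong (f≈ [] z<s) (g≈ (a ∷ α) ℕ.≤-refl))
           (⋆-exchangeˡ α (λ β β<α → f≈ (a ∷ β) (s<s β<α)) (λ γ γ≤α → g≈ γ (ℕ.m≤n⇒m≤1+n γ≤α)) g1) ⟩
    f′ [] * g′ (a ∷ α) + (((f′ ∘ (a ∷_)) ⋆ g′) α + f (a ∷ α))
      ≈⟨ +-assoc _ _ _ ⟨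
    f′ [] * g′ (a ∷ α) + ((f′ ∘ (a ∷_)) ⋆ g′) α + f (a ∷ α) ∎

  -- Only the two extreme cuts of `a ∷ α` involve a value at `a ∷ α` itself. All other terms use
  -- shorter compositions, where the two pairs agree, and cancel.
  ⋆-leading-terms : ∀ {f f′ g g′} a α →
    (∀ β → length β < suc (length α) → f β ≈ f′ β) → (∀ γ → length γ < suc (length α) → g γ ≈ g′ γ) →
    f [] ≈ 1# → g [] ≈ 1# → (f ⋆ g) (a ∷ α) ≈ (f′ ⋆ g′) (a ∷ α) →
    f (a ∷ α) + g (a ∷ α) ≈ f′ (a ∷ α) + g′ (a ∷ α)
  ⋆-leading-terms {f} {f′} {g} {g′} a α f≈ g≈ f1 g1 eq = +-cancelʳ X′ _ _ (begin
    (p + q) + X′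
      ≈⟨ solve 3 (λ p q x → (p :+ q) :+ x := q :+ (x :+ p)) refl p q X′ ⟩
    q + (X′ + p)
      ≈⟨ +-congˡ (⋆-exchangeˡ α (λ β β<α → f≈ (a ∷ β) (s<s β<α)) (λ γ γ≤α → g≈ γ (s≤s γ≤α)) g1) ⟨
    q + (X + p′)
      ≈⟨ solve 3 (λ p q x → q :+ (x :+ p) := p :+ (con 1 :* q :+ x)) refl p′ q X ⟩
    p′ + (1# * q + X)
      ≈⟨ +-congˡ (+-congʳ (*-congʳ f1)) ⟨
    p′ + (f [] * q + X)
      ≈⟨ +-congˡ eq ⟩
    p′ + (f′ [] * q′ + X′)
      ≈⟨ +-congˡ (+-congʳ (*-congʳ (trans (sym (f≈ [] z<s)) f1))) ⟩
    p′ + (1# * q′ + X′)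
      ≈⟨ solve 3 (λ p q x → p :+ (con 1 :* q :+ x) := (p :+ q) :+ x) refl p′ q′ X′ ⟩
    (p′ + q′) + X′ ∎)
    where
    p  = f (a ∷ α)
    p′ = f′ (a ∷ α)
    q  = g (a ∷ α)
    q′ = g′ (a ∷ α)
    X  = ((f ∘ (a ∷_)) ⋆ g) α
    X′ = ((f′ ∘ (a ∷_)) ⋆ g′) α

  leadingOdd : Sequence → Series
  leadingOdd f []        = f 0
  leadingOdd f α@(a ∷ _) = if isEven (value a) then 0# else f (kₒ α)

  -- A cut contributes only if its right piece is empty or starts with an odd part. So each number
  -- of odd parts in the left piece, from 0 to `kₒ α`, occurs exactly once.
  ⋆-leadingOdd : ∀ f g α → ((f ∘ kₒ) ⋆ leadingOdd g) α ≈ (f ⊛ g) (kₒ α)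
  ⋆-leadingOdd f g []      = refl
  ⋆-leadingOdd f g (a ∷ α) with isEven (value a)
  ... | true  = trans (+-cong (zeroʳ _) (⋆-leadingOdd f g α)) (+-identityˡ _)
  ... | false = +-congˡ (⋆-leadingOdd (f ∘ suc) g α)

  -- If the first part is even, every cut has a piece starting with it and contributes 0. If it is
  -- odd, all nonempty left pieces start with it, so the sum is a full convolution at a positive
  -- index.
  leadingOdd-⋆-leadingOdd : ∀ f g α → (∀ n → (f ⊛ g) (suc n) ≈ 0#) → f 0 * g 0 ≈ 1# →
    (leadingOdd f ⋆ leadingOdd g) α ≈ counit α
  leadingOdd-⋆-leadingOdd f g []      vanish unit = unit
  leadingOdd-⋆-leadingOdd f g (a ∷ α) vanish unit with isEven (value a)
  ... | true  = trans (+-cong (zeroʳ _) (⋆-zeroˡ (λ _ → refl) (leadingOdd g) α)) (+-identityˡ 0#)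
  ... | false = trans (+-congˡ (⋆-leadingOdd (f ∘ suc) g α)) (vanish (kₒ α))

  -- From functionals to their values on the basis.

  ∗≈⋆ : ∀ ρ ψ α → (ρ ∗ ψ) (M α) ≈ ((ρ ∘ M) ⋆ (ψ ∘ M)) α
  ∗≈⋆ ρ ψ = go (ρ ∘ M)
    where
    term : Series → Carrier × Composition × Composition → Carrier
    term f (x , β , γ) = x * (f β * ψ (M γ))
    ∑-shift : ∀ f a xs →
      ∑ᴿ (term f) (map (1# ,_) (map (map₁ (a ∷_)) xs) ++ []) ≡
      ∑ᴿ (term (f ∘ (a ∷_))) (map (1# ,_) xs ++ [])
    ∑-shift f a []       = ≡.refl
    ∑-shift f a (x ∷ xs) = ≡.cong (term (f ∘ (a ∷_)) (1# , x) +_) (∑-shift f a xs)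
    -- The left factor must be arbitrary here, since the recursion replaces it by its shifts.
    go : ∀ f α → ∑ᴿ (term f) (map (1# ,_) (deconcat α) ++ []) ≈ (f ⋆ (ψ ∘ M)) α
    go f []      = trans (+-identityʳ _) (*-identityˡ _)
    go f (a ∷ α) = +-cong (*-identityˡ _)
      (trans (reflexive (∑-shift f a (deconcat α))) (go (f ∘ (a ∷_)) α))

  ε-M : ∀ α → ε (M α) ≈ counit α
  ε-M []      = trans (+-identityʳ _) (trans (*-identityˡ _) (+-identityʳ 1#))
  ε-M (_ ∷ _) = trans (+-identityʳ _) (*-identityˡ 0#)

  barₛ : Series → Series
  barₛ f α = sgn (size α) * f α

  bar-M : ∀ {φ} → IsCharacter φ → ∀ α → bar φ (M α) ≈ barₛ (φ ∘ M) α
  bar-M isChar α = IsCharacter.*ₗ-homo isChar (sgn (size α)) (M α)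

  character-M[] : ∀ {φ} → IsCharacter φ → φ (M []) ≈ 1#
  character-M[] {φ} isChar = IsRingHomomorphism.1#-homo (IsCharacter.isRingHomomorphism isChar)
    where open RingMorphisms QSym-rawRing rawRing using (IsRingHomomorphism)

  -- After one part is split off, ζ admits no second, so the shifted ζ is the counit. Hence ζ ζ⁻¹ =
  -- ε says that prepending a part to α changes the sign of the value of ζ⁻¹.
  ζ⁻¹-M : ∀ {ζ⁻¹} → IsCharacter ζ⁻¹ → IsInverse ζ ζ⁻¹ → ∀ α → ζ⁻¹ (M α) ≈ sgn (length α)
  ζ⁻¹-M       isChar inv []      = character-M[] isChar
  ζ⁻¹-M {ζ⁻¹} isChar inv (a ∷ α) = begin
    ζ⁻¹ (M (a ∷ α))       ≈⟨ +-inverseˡ-unique _ _ sum≈0 ⟩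
    - ζ⁻¹ (M α)           ≈⟨ -‿cong (ζ⁻¹-M isChar inv α) ⟩
    - sgn (length α)      ≈⟨ -1*x≈-x _ ⟨
    sgn (length (a ∷ α))  ∎
    where
    simplify : ∀ x → x * 1# + 0# ≈ x
    simplify x = trans (+-identityʳ _) (*-identityʳ x)
    ζ-M-single : ∀ β → ζ (M (a ∷ β)) ≈ counit β
    ζ-M-single []      = simplify 1#
    ζ-M-single (_ ∷ _) = trans (+-identityʳ _) (zeroʳ 1#)
    sum≈0 : ζ⁻¹ (M (a ∷ α)) + ζ⁻¹ (M α) ≈ 0#
    sum≈0 = begin
      ζ⁻¹ (M (a ∷ α)) + ζ⁻¹ (M α)
        ≈⟨ +-cong (trans (*-congʳ (simplify 1#)) (*-identityˡ _)) (⋆-identityˡ ζ-M-single (ζ⁻¹ ∘ M) α) ⟨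
      ((ζ ∘ M) ⋆ (ζ⁻¹ ∘ M)) (a ∷ α)
        ≈⟨ ∗≈⋆ ζ ζ⁻¹ (a ∷ α) ⟨
      (ζ ∗ ζ⁻¹) (M (a ∷ α))
        ≈⟨ trans (proj₁ inv (M (a ∷ α))) (ε-M (a ∷ α)) ⟩
      0# ∎

  -- The trace of a factorisation on the basis: equations that can be solved by recursion on length
  -- once 2 is invertible. Evenness appears as vanishing in odd degree.
  record IsEvenOddSeriesFactorisation (f f₊ f₋ : Series) : Set (c ⊔ ℓ) where
    field
      f₊[]≈1  : f₊ [] ≈ 1#
      f₋[]≈1  : f₋ [] ≈ 1#
      f₊-even : ∀ α → isEven (size α) ≡ false → f₊ α ≈ 0#
      f₋-odd  : ∀ α → (f₋ ⋆ barₛ f₋) α ≈ counit α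
      factors : ∀ α → (f₊ ⋆ f₋) α ≈ f α

  module _ (½ : Carrier) (½*2≈1 : ½ * (1# + 1#) ≈ 1#) where

    halve-double : ∀ z → ½ * (z + z) ≈ z
    halve-double z = begin
      ½ * (z + z)          ≈⟨ solve 2 (λ h z → h :* (z :+ z) := (h :* con 2) :* z) refl ½ z ⟩
      ½ * (1# + 1#) * z    ≈⟨ *-congʳ ½*2≈1 ⟩
      1# * z               ≈⟨ *-identityˡ z ⟩
      z                    ∎

    double-cancel : ∀ {x y} → x + x ≈ y + y → x ≈ y
    double-cancel {x} {y} eq = begin
      x            ≈⟨ halve-double x ⟨
      ½ * (x + x)  ≈⟨ *-congˡ eq ⟩
      ½ * (y + y)  ≈⟨ halve-double y ⟩
      y            ∎

    odd⇒zero : ∀ n {x} → isEven n ≡ false → sgn n * x ≈ x → x ≈ 0#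
    odd⇒zero n {x} odd eq = double-cancel (begin
      x + x          ≈⟨ +-congʳ eq ⟨
      sgn n * x + x  ≈⟨ +-congʳ (trans (*-congʳ sgn≈-1) (-1*x≈-x x)) ⟩
      - x + x        ≈⟨ -‿inverseˡ x ⟩
      0#             ≈⟨ +-identityˡ 0# ⟨
      0# + 0#        ∎)
      where
      sgn≈-1 : sgn n ≈ - 1#
      sgn≈-1 = trans (sgn-isEven n) (reflexive (≡.cong (if_then 1# else - 1#) odd))

    seriesFactorisation : ∀ {φ φ₊ φ₋ f} → IsEvenOddFactorisation φ φ₊ φ₋ →
      (∀ α → φ (M α) ≈ f α) → IsEvenOddSeriesFactorisation f (φ₊ ∘ M) (φ₋ ∘ M)
    seriesFactorisation {φ} {φ₊} {φ₋} F φ≈f = record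
      { f₊[]≈1  = character-M[] φ₊-isCharacter
      ; f₋[]≈1  = character-M[] φ₋-isCharacter
      ; f₊-even = λ α odd →
          odd⇒zero (size α) odd (trans (sym (bar-M φ₊-isCharacter α)) (φ₊-isEven (M α)))
      ; f₋-odd  = λ α → begin
          ((φ₋ ∘ M) ⋆ barₛ (φ₋ ∘ M)) α
            ≈⟨ ⋆-cong {f = φ₋ ∘ M} (λ _ → refl) (bar-M φ₋-isCharacter) α ⟨
          ((φ₋ ∘ M) ⋆ (bar φ₋ ∘ M)) α
            ≈⟨ ∗≈⋆ φ₋ (bar φ₋) α ⟨
          (φ₋ ∗ bar φ₋) (M α)
            ≈⟨ trans (proj₁ φ₋-isOdd (M α)) (ε-M α) ⟩
          counit α ∎
      ; factors = λ α →
          trans (sym (∗≈⋆ φ₊ φ₋ α)) (trans (sym (factors (M α))) (φ≈f α))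
      }
      where open IsEvenOddFactorisation F

    -- Uniqueness of the factorisation.

    module _ {f f₊ f₋ g₊ g₋ : Series}
      (F : IsEvenOddSeriesFactorisation f f₊ f₋) (G : IsEvenOddSeriesFactorisation f g₊ g₋) where

      private
        module F = IsEvenOddSeriesFactorisation F
        module G = IsEvenOddSeriesFactorisation G

      Agree : Composition → Set ℓ
      Agree α = (f₊ α ≈ g₊ α) × (f₋ α ≈ g₋ α)

      leading₊₋ : ∀ a α → (∀ β → length β < suc (length α) → Agree β) →
        f₊ (a ∷ α) + f₋ (a ∷ α) ≈ g₊ (a ∷ α) + g₋ (a ∷ α)
      leading₊₋ a α ih =
        ⋆-leading-terms a α (λ β → proj₁ ∘ ih β) (λ β → proj₂ ∘ ih β) F.f₊[]≈1 F.f₋[]≈1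
          (trans (F.factors (a ∷ α)) (sym (G.factors (a ∷ α))))

      -- In even degree f₋ ⋆ barₛ f₋ has leading term 2 f₋, which determines f₋;
      -- in odd degree f₊ vanishes. The product f₊ ⋆ f₋ then gives the other factor.
      agree-step : ∀ α → (∀ β → length β < length α → Agree β) → Agree α
      agree-step []      _  = trans F.f₊[]≈1 (sym G.f₊[]≈1) , trans F.f₋[]≈1 (sym G.f₋[]≈1)
      agree-step (a ∷ α) ih with isEven (size (a ∷ α)) in parity
      ... | false = f₊≈g₊ , +-cancelˡ _ _ _ (trans (leading₊₋ a α ih) (+-congʳ (sym f₊≈g₊)))
        where
        f₊≈g₊ = trans (F.f₊-even (a ∷ α) parity) (sym (G.f₊-even (a ∷ α) parity))
      ... | true  = +-cancelʳ _ _ _ (trans (leading₊₋ a α ih) (+-congˡ (sym f₋≈g₋))) , f₋≈g₋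
        where
        leading₋ : f₋ (a ∷ α) + barₛ f₋ (a ∷ α) ≈ g₋ (a ∷ α) + barₛ g₋ (a ∷ α)
        leading₋ = ⋆-leading-terms a α
          (λ β → proj₂ ∘ ih β) (λ β → *-congˡ ∘ proj₂ ∘ ih β)
          F.f₋[]≈1 (trans (*-identityˡ _) F.f₋[]≈1)
          (trans (F.f₋-odd (a ∷ α)) (sym (G.f₋-odd (a ∷ α))))
        barₛ-fixed : ∀ h → barₛ h (a ∷ α) ≈ h (a ∷ α)
        barₛ-fixed h = trans
          (*-congʳ (trans (sgn-isEven (size (a ∷ α)))
            (reflexive (≡.cong (if_then 1# else - 1#) parity))))
          (*-identityˡ _)
        f₋≈g₋ : f₋ (a ∷ α) ≈ g₋ (a ∷ α)
        f₋≈g₋ = double-cancel (trans (+-congˡ (sym (barₛ-fixed f₋)))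
          (trans leading₋ (+-congˡ (barₛ-fixed g₋))))

      agree : ∀ α → Agree α
      agree α = go (suc (length α)) α ℕ.≤-refl
        where
        go : ∀ n α → length α < n → Agree α
        go (suc n) α (s≤s α≤n) = agree-step α (λ β β<α → go n β (ℕ.<-≤-trans β<α α≤n))

    -- The explicit factors of ζ⁻¹.

    b : Sequence
    b j = ½ ^ (2 Nat.* j) * (central j · 1#)

    ¼^n*4^n≈1 : ∀ n → (½ ^ 2) ^ n * ((4 Nat.^ n) · 1#) ≈ 1#
    ¼^n*4^n≈1 zero    = trans (*-identityˡ _) (+-identityʳ 1#)
    ¼^n*4^n≈1 (suc n) = begin
      (½ ^ 2 * q) * ((4 Nat.* 4 Nat.^ n) · 1#)
        ≈⟨ *-congˡ (×1-homo-* 4 (4 Nat.^ n)) ⟩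
      (½ ^ 2 * q) * ((4 · 1#) * p)
        -- The `1#` in `4 · 1#` is abstracted as `o`; `con 4` then provides the four summands that
        -- the two factors ½ reduce to 1.
        ≈⟨ solve 4 (λ h o q p →
             ((h :* (h :* con 1)) :* q) :* ((o :+ (o :+ (o :+ (o :+ con 0)))) :* p) :=
             ((h :* (h :* con 4)) :* o) :* (q :* p)) refl ½ 1# q p ⟩
      ((½ * (½ * (1# + 1# + 1# + 1#))) * 1#) * (q * p)
        ≈⟨ *-cong (*-identityʳ _) (¼^n*4^n≈1 n) ⟩
      (½ * (½ * (1# + 1# + 1# + 1#))) * 1#
        ≈⟨ *-identityʳ _ ⟩
      ½ * (½ * (1# + 1# + 1# + 1#))
        ≈⟨ *-congˡ (*-congˡ (+-assoc _ _ _)) ⟩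
      ½ * (½ * ((1# + 1#) + (1# + 1#)))
        ≈⟨ *-congˡ (halve-double _) ⟩
      ½ * (1# + 1#)
        ≈⟨ ½*2≈1 ⟩
      1# ∎
      where
      q = (½ ^ 2) ^ n
      p = (4 Nat.^ n) · 1#

    -- The terms of `b` are the coefficients of (1 - x)^(-1/2), whose square is 1 / (1 - x).
    b⊛b : ∀ n → (b ⊛ b) n ≈ 1#
    b⊛b n = begin
      (b ⊛ b) n
        ≈⟨ ⊛-cong b≈ b≈ n ⟩
      ((λ j → (½ ^ 2) ^ j * (central j · 1#)) ⊛ (λ j → (½ ^ 2) ^ j * (central j · 1#))) n
        ≈⟨ ⊛-geometric (½ ^ 2) (λ j → central j · 1#) (λ j → central j · 1#) n ⟩
      (½ ^ 2) ^ n * ((λ j → central j · 1#) ⊛ (λ j → central j · 1#)) n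
        ≈⟨ *-congˡ (⊛-homo-· central central n) ⟩
      (½ ^ 2) ^ n * ((central ⊛ℕ central) n · 1#)
        ≡⟨ ≡.cong (λ m → (½ ^ 2) ^ n * (m · 1#)) (central⊛central n) ⟩
      (½ ^ 2) ^ n * ((4 Nat.^ n) · 1#)
        ≈⟨ ¼^n*4^n≈1 n ⟩
      1# ∎
      where
      b≈ : ∀ j → b j ≈ (½ ^ 2) ^ j * (central j · 1#)
      b≈ j = *-congʳ (sym (^-assocʳ ½ 2 j))

    b∘half : Sequence
    b∘half n = b ⌊ n /2⌋

    -- With x marking odd parts and signs set aside, the sequences behind them are (1 - x²)^(-1/2)
    -- and (1 + x) (1 - x²)^(-1/2). Their product is 1 / (1 - x), the constant sequence 1 behind
    -- ζ⁻¹.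
    evenFactor oddFactor : Series
    evenFactor = signed (evenPart b ∘ kₒ)
    oddFactor  = signed (leadingOdd b∘half)

    evenPart-b-⊛-b∘half : ∀ n → (evenPart b ⊛ b∘half) n ≈ 1#
    evenPart-b-⊛-b∘half n = begin
      (evenPart b ⊛ b∘half) n
        ≈⟨ ⊛-cong {f = evenPart b} (λ _ → refl) (λ i → *-identityˡ (b∘half i)) n ⟨
      (evenPart b ⊛ (λ i → 1# * b∘half i)) n
        ≈⟨ evenPart-⊛ (λ _ → 1#) (λ _ → refl) b b n ⟩
      1# * (b ⊛ b) ⌊ n /2⌋
        ≈⟨ trans (*-identityˡ _) (b⊛b ⌊ n /2⌋) ⟩
      1# ∎

    sgn*b∘half : Sequence
    sgn*b∘half n = sgn n * b∘half n

    -- The series (1 + x) (1 - x²)^(-1/2) times its image under x ↦ -x is 1.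
    b∘half-⊛-sgn*b∘half : ∀ n → (b∘half ⊛ sgn*b∘half) (suc n) ≈ 0#
    b∘half-⊛-sgn*b∘half n = begin
      (b∘half ⊛ sgn*b∘half) (suc n)
        ≈⟨ halved-⊛-alternating b b n ⟩
      sgn (suc n) * (b ⊛ b) ⌊ suc n /2⌋ + sgn n * (b ⊛ b) ⌊ n /2⌋
        ≈⟨ +-cong (times-1 (suc n)) (times-1 n) ⟩
      sgn (suc n) + sgn n
        ≈⟨ sgn-suc+sgn n ⟩
      0# ∎
      where
      times-1 : ∀ m → sgn m * (b ⊛ b) ⌊ m /2⌋ ≈ sgn m
      times-1 m = trans (*-congˡ (b⊛b ⌊ m /2⌋)) (*-identityʳ _)

    b0≈1 : b 0 ≈ 1#
    b0≈1 = trans (*-identityˡ _) (+-identityʳ 1#)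

    -- The degree and the number of odd parts have the same parity, so the bar acts on the
    -- underlying sequence as x ↦ -x.
    barₛ-oddFactor : ∀ α → barₛ oddFactor α ≈ signed (leadingOdd sgn*b∘half) α
    barₛ-oddFactor α = begin
      sgn (size α) * (sgn (length α) * leadingOdd b∘half α)
        ≈⟨ solve 3 (λ s t x → s :* (t :* x) := t :* (s :* x)) refl
             (sgn (size α)) (sgn (length α)) (leadingOdd b∘half α) ⟩
      sgn (length α) * (sgn (size α) * leadingOdd b∘half α)
        ≈⟨ *-congˡ (trans (*-congʳ (sgn-size α)) (sgn-leadingOdd α)) ⟩
      sgn (length α) * leadingOdd sgn*b∘half α ∎
      where
      sgn-leadingOdd : ∀ α → sgn (kₒ α) * leadingOdd b∘half α ≈ leadingOdd sgn*b∘half α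
      sgn-leadingOdd []        = refl
      sgn-leadingOdd (a ∷ α) with isEven (value a)
      ... | true  = zeroʳ _
      ... | false = refl

    signed-counit : ∀ α → signed counit α ≈ counit α
    signed-counit []      = *-identityˡ 1#
    signed-counit (_ ∷ _) = zeroʳ _

    explicitFactorisation : IsEvenOddSeriesFactorisation (sgn ∘ length) evenFactor oddFactor
    explicitFactorisation = record
      { f₊[]≈1  = trans (*-identityˡ _) b0≈1
      ; f₋[]≈1  = trans (*-identityˡ _) b0≈1
      ; f₊-even = λ α odd → trans
          (*-congˡ (reflexive (≡.cong (if_then b ⌊ kₒ α /2⌋ else 0#)
            (≡.trans (≡.sym (isEven-size α)) odd))))
          (zeroʳ _)
      ; f₋-odd  = λ α → begin
          (oddFactor ⋆ barₛ oddFactor) α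
            ≈⟨ ⋆-cong {f = oddFactor} (λ _ → refl) barₛ-oddFactor α ⟩
          (oddFactor ⋆ signed (leadingOdd sgn*b∘half)) α
            ≈⟨ signed-⋆ (leadingOdd b∘half) (leadingOdd sgn*b∘half) α ⟩
          signed (leadingOdd b∘half ⋆ leadingOdd sgn*b∘half) α
            ≈⟨ *-congˡ (leadingOdd-⋆-leadingOdd b∘half sgn*b∘half α b∘half-⊛-sgn*b∘half unit) ⟩
          signed counit α
            ≈⟨ signed-counit α ⟩
          counit α ∎
      ; factors = λ α → begin
          (evenFactor ⋆ oddFactor) α
            ≈⟨ signed-⋆ (evenPart b ∘ kₒ) (leadingOdd b∘half) α ⟩
          signed ((evenPart b ∘ kₒ) ⋆ leadingOdd b∘half) α
            ≈⟨ *-congˡ (⋆-leadingOdd (evenPart b) b∘half α) ⟩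
          sgn (length α) * (evenPart b ⊛ b∘half) (kₒ α)
            ≈⟨ trans (*-congˡ (evenPart-b-⊛-b∘half (kₒ α))) (*-identityʳ _) ⟩
          sgn (length α) ∎
      }
      where
      unit : b∘half 0 * sgn*b∘half 0 ≈ 1#
      unit = trans (*-cong b0≈1 (trans (*-identityˡ _) b0≈1)) (*-identityˡ 1#)

module _ {c ℓ₁ ℓ₂} (K : HeytingField c ℓ₁ ℓ₂) (2#0 : Char≠2 K) where

  private
    R = HeytingField⇒CommutativeRing K

  open CommutativeRing R
  open QuasiSymmetric R using (Functional; IsCharacter; IsInverse; IsEvenOddFactorisation; M; ζ)
  open EvenOdd R
  open Values K 2#0
  open SemiringExp semiring using (^-congʳ)

  ½*2≈1 : ½ * (1# + 1#) ≈ 1#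
  ½*2≈1 = trans
    (*-congˡ (sym (trans (+-congˡ (RingProperties.-0#≈0# ring)) (+-identityʳ _))))
    (proj₁ (proj₂ (HeytingField.#⇒invertible K 2#0)))

  oddFactor≈value : ∀ α → oddFactor ½ ½*2≈1 α ≈ ζ⁻¹₋-value α
  oddFactor≈value []      = trans (*-identityˡ _) (b0≈1 ½ ½*2≈1)
  oddFactor≈value (a ∷ α) with isEven (value a)
  ... | true  = zeroʳ _
  ... | false = sym (*-assoc _ _ _)

  evenFactor≈value : ∀ α → evenFactor ½ ½*2≈1 α ≈ ζ⁻¹₊-value (size α) α
  evenFactor≈value α rewrite isEven-size α with isEven (kₒ α) in parity
  ... | true  = trans
    -- For an even number of odd parts, the exponent 2 ⌊kₒ / 2⌋ in `b` is the exponent `kₒ α` of the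
    -- stated value.
    (*-congˡ (*-congʳ (^-congʳ ½ (≡.sym (isEven⇒n≡2*⌊n/2⌋ (kₒ α) parity)))))
    (sym (*-assoc _ _ _))
  ... | false = zeroʳ _

theorem8p4 : ∀ {c ℓ₁ ℓ₂} (K : HeytingField c ℓ₁ ℓ₂) (2#0 : Char≠2 K) →
    let open HeytingField K
        open QuasiSymmetric (HeytingField⇒CommutativeRing K)
        open Values K 2#0 in
    (ζ⁻¹ ζ⁻¹₊ ζ⁻¹₋ : Functional) →
    IsCharacter ζ⁻¹ →
    IsInverse ζ ζ⁻¹ →
    IsEvenOddFactorisation ζ⁻¹ ζ⁻¹₊ ζ⁻¹₋ →
    (n : ℕ) (α : Composition) → size α ≡ n →
    (ζ⁻¹₋ (M α) ≈ ζ⁻¹₋-value α) × (ζ⁻¹₊ (M α) ≈ ζ⁻¹₊-value n α)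
theorem8p4 K 2#0 ζ⁻¹ ζ⁻¹₊ ζ⁻¹₋ isChar isInv factorisation _ α ≡.refl =
  trans (proj₂ factors≈) (oddFactor≈value K 2#0 α) ,
  trans (proj₁ factors≈) (evenFactor≈value K 2#0 α)
  where
  open HeytingField K using (trans)
  open EvenOdd (HeytingField⇒CommutativeRing K)
  open Values K 2#0 using (½)
  factors≈ = agree ½ (½*2≈1 K 2#0)
    (seriesFactorisation ½ (½*2≈1 K 2#0) factorisation (ζ⁻¹-M isChar isInv))
    (explicitFactorisation ½ (½*2≈1 K 2#0)) α
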